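{- In the natural deduction system $\mathsf{CD}$, for all formulas $A,B$, first-order variables $\alpha$ and proof terms $t$: 1. If $\mathsf{CD}\vdash t:\exists\alpha\,A$ and $t$ is in normal form, then $t=(m,u)$ for some first-order term $m$ and proof term $u$, and $\mathsf{CD}\vdash u:A[m/\alpha]$. 2. If $\mathsf{CD}\vdash t:A\lor B$ and $t$ is in normal form, then either $t=\iota_0(u)$ and $\mathsf{CD}\vdash u:A$, or $t=\iota_1(u)$ and $\mathsf{CD}\vdash u:B$, for some proof term $u$. 3. If $\mathsf{CD}\vdash t:\forall\alpha\,A$ and $t$ is in normal form, then $t=\lambda\alpha\,u$ for some proof term $u$, and $\mathsf{CD}\vdash u:A$.
   Context: **Language $\mathcal{L}$ of $\mathsf{CD}$.** First-order terms are variables $\alpha,\beta,\dots$, constants $\mathsf{c}$, and expressions $\mathsf{f}(m_1,\dots,m_n)$ with $\mathsf{f}$ an $n$-ary function constant and $m_1,\dots,m_n$ terms. There is a countable set of predicate symbols, including a $0$-ary symbol $\bot$ (falsity). Atomic formulas are $\mathcal{P}(m_1,\dots,m_n)$ with $\mathcal{P}$ an $n$-ary predicate symbol. Formulas are built from atomic formulas with $\lor,\land,\rightarrow,\forall,\exists$; $\lnot A$ abbreviates $A\rightarrow\bot$. A constant $\mathsf{0}$ of $\mathcal{L}$ is fixed. **Typing rules of $\mathsf{CD}$** (natural deduction with proof terms; proof-term variables $x^A$ carry their type $A$; square-bracketed assumptions are discharged; terms are considered up to renaming of bound variables and substitution is capture-avoiding). - Axiom: $x^A : A$. - Conjunction: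 from $u:A$ and $t:B$ infer $\langle u,t\rangle : A\wedge B$; from $u:A\wedge B$ infer $u\,\pi_0 : A$ and $u\,\pi_1 : B$. - Implication: from $t:A\rightarrow B$ and $u:A$ infer $t\,u:B$; from $u:B$ infer $\lambda x^A u : A\rightarrow B$ (binding $x^A$, discharging $[x^A:A]$). - Disjunction: from $u:A$ infer $\iota_0(u):A\lor B$; from $u:B$ infer $\iota_1(u):A\lor B$; from $u:A\lor B$, $w_1:C$ and $w_2:C$ infer $u\,[x^A.w_1,\,y^B.w_2] : C$ (binding $x^A$ in $w_1$ and $y^B$ in $w_2$). - Universal quantifier: from $u:\forall\alpha\,A$ infer $u\,m : A[m/\alpha]$ for any term $m$ of $\mathcal{L}$; from $u:A$ infer $\lambda\alpha\,u:\forall\alpha\,A$, provided $\alpha$ does not occur free in the type $B$ of any free variable $x^B$ of $u$. - Existential quantifier: from $u:A[m/\alpha]$ infer $(m,u):\exists\alpha\,A$; from $u:\exists\alpha\,A$ and $t:C$ infer $u\,[(\alpha,x^A).t]:C$ (binding $\alpha$ and $x^A$ in $t$), provided $\alpha$ is not free in $C$ nor in the type $B$ of any free variable of $t$ other than $x^A$. - Constant domain axiom: for each formula $I=\forall\alpha(A\lor B)\rightarrow \forall\alpha A\lor B$ with $\alpha$ not occurring in $B$, a constant $\mathcal{D}^I : I$ (also written $\mathcal{D}$). - Ex falso: from $u:\bot$ infer $\mathsf{efq}_P\,u : P$, with $P$ atomic. The notation $\mathsf{CD}\vdash t:A$ means that $t:A$ is derivable without assumptions, i.e. $t$ has type $A$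 and has no free proof-term variables (free first-order variables are allowed). **Reduction rules.** $(\lambda x.u)t\mapsto u[t/x]$; $(\lambda\alpha.u)m\mapsto u[m/\alpha]$; $\langle u_0,u_1\rangle\pi_i\mapsto u_i$ for $i=0,1$; $\iota_i(u)[x_0.t_0,x_1.t_1]\mapsto t_i[u/x_i]$ for $i=0,1$; $(m,u)[(\alpha,x).v]\mapsto v[m/\alpha][u/x]$ for each term $m$ of $\mathcal{L}$; $\mathcal{D}(\lambda\alpha\,\iota_0(u))\mapsto\iota_0(\lambda\alpha\,u)$; $\mathcal{D}(\lambda\alpha\,\iota_1(u))\mapsto\iota_1(u[\mathsf{0}/\alpha])$. For arbitrary proof terms, $t\mapsto u$ holds whenever $u$ is obtained from $t$ by applying one reduction rule to a subterm of $t$. A proof term $t$ is in normal form if there is no $u$ with $t\mapsto u$. -}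

module Defs where

open import Data.Fin.Base using (Fin; zero; suc)
open import Data.Fin.Substitution
  using (Sub; Simple; Application; Lift; TermSubst; module VarSubst)
open import Data.Nat.Base using (ℕ; zero; suc)
open import Data.Product.Base using (Σ)
open import Data.Vec.Base using (Vec; []; _∷_; lookup; map)
open import Function.Bundles using (_↣_)
open import Relation.Binary.Rewriting using (IsNormalForm)

-- FunSym n and PredSym n are the function constants and the predicate
-- symbols of arity n.

record Language : Set₁ where
  field
    Const        : Set
    𝟘            : Const
    FunSym       : ℕ → Set
    PredSym      : ℕ → Set
    pred-counted : Σ ℕ PredSym ↣ ℕ
    ⊥-sym        : PredSym 0

-- The system CD over 𝓛, with well-scoped de Bruijn indices, so that syntactic
-- equality is equality up to renaming of bound variables.  Index n bounds the
-- free first-order variables, and index k the free proof-term variables.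

module CD (𝓛 : Language) where

  open Language 𝓛 public

  private
    variable
      n m k l : ℕ

  ----------------------------------------------------------------------
  -- First-order terms

  data Term (n : ℕ) : Set where
    var   : Fin n → Term n
    const : Const → Term n
    fun   : FunSym l → Vec (Term n) l → Term n

  module TermApp {T : ℕ → Set} (lft : Lift T Term) where
    open Lift lft using (lift)

    infixl 8 _/_ _/s_

    mutual
      _/_ : Term n → Sub T n m → Term m
      var x    / σ = lift (lookup σ x)
      const c  / σ = const c
      fun f ms / σ = fun f (ms /s σ)

      _/s_ : Vec (Term n) l → Sub T n m → Vec (Term m) l
      []       /s σ = []
      (t ∷ ts) /s σ = (t / σ) ∷ (ts /s σ)

  termSubst : TermSubst Term
  termSubst = record { var = var ; app = TermApp._/_ }

  open TermSubst termSubst public using (_↑; wk; sub; termLift)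
  open TermApp termLift public using (_/_; _/s_)

  ----------------------------------------------------------------------
  -- Formulas

  data Atom (n : ℕ) : Set where
    _⦅_⦆ : PredSym l → Vec (Term n) l → Atom n

  infix  9 _⦅_⦆
  infixr 7 _∧_
  infixr 6 _∨_
  infixr 5 _⇒_
  infix  8 ∀′_ ∃′_

  data Formula (n : ℕ) : Set where
    atom        : Atom n → Formula n
    _∧_ _∨_ _⇒_ : Formula n → Formula n → Formula n
    ∀′_ ∃′_     : Formula (suc n) → Formula n

  ⊥ᶠ : Formula n
  ⊥ᶠ = atom (⊥-sym ⦅ [] ⦆)

  infixl 10 _/ᵃ_ _/ᶠ_

  _/ᵃ_ : Atom n → Sub Term n m → Atom m
  (P ⦅ ms ⦆) /ᵃ σ = P ⦅ ms /s σ ⦆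

  _/ᶠ_ : Formula n → Sub Term n m → Formula m
  atom P  /ᶠ σ = atom (P /ᵃ σ)
  (A ∧ B) /ᶠ σ = (A /ᶠ σ) ∧ (B /ᶠ σ)
  (A ∨ B) /ᶠ σ = (A /ᶠ σ) ∨ (B /ᶠ σ)
  (A ⇒ B) /ᶠ σ = (A /ᶠ σ) ⇒ (B /ᶠ σ)
  (∀′ A)  /ᶠ σ = ∀′ (A /ᶠ (σ ↑))
  (∃′ A)  /ᶠ σ = ∃′ (A /ᶠ (σ ↑))

  weakenᶠ : Formula n → Formula (suc n)
  weakenᶠ A = A /ᶠ wk

  infixl 10 _[_]ᶠ

  _[_]ᶠ : Formula (suc n) → Term n → Formula n
  A [ m ]ᶠ = A /ᶠ sub m

  ----------------------------------------------------------------------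
  -- Proof terms

  -- Variables carry their type at the place where they are bound; those that
  -- are free get it from the context of the typing judgement.

  infixl 9 _·_ _·ᵗ_

  data Proof (n k : ℕ) : Set where
    var    : Fin k → Proof n k
    ⟨_,_⟩  : Proof n k → Proof n k → Proof n k
    _π₀    : Proof n k → Proof n k
    _π₁    : Proof n k → Proof n k
    _·_    : Proof n k → Proof n k → Proof n k
    ƛ      : Formula n → Proof n (suc k) → Proof n k
    ι₀     : Proof n k → Proof n k
    ι₁     : Proof n k → Proof n k
    -- case u A w₁ B w₂  is  u [xᴬ.w₁, yᴮ.w₂]
    case   : Proof n k → Formula n → Proof n (suc k) →
             Formula n → Proof n (suc k) → Proof n k
    _·ᵗ_   : Proof n k → Term n → Proof n k
    Λ      : Proof (suc n) k → Proof n k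
    pack   : Term n → Proof n k → Proof n k
    -- unpack u A t  is  u [(α,xᴬ).t]
    unpack : Proof n k → Formula (suc n) → Proof (suc n) (suc k) → Proof n k
    -- 𝒟 A B  is  𝒟ᴵ  for  I = ∀α(A ∨ B) → ∀α A ∨ B
    𝒟      : Formula (suc n) → Formula n → Proof n k
    efq    : Atom n → Proof n k → Proof n k

  infixl 10 _/ᵖ_

  _/ᵖ_ : Proof n k → Sub Term n m → Proof m k
  var x            /ᵖ σ = var x
  ⟨ u , t ⟩        /ᵖ σ = ⟨ u /ᵖ σ , t /ᵖ σ ⟩
  (u π₀)           /ᵖ σ = (u /ᵖ σ) π₀
  (u π₁)           /ᵖ σ = (u /ᵖ σ) π₁
  (t · u)          /ᵖ σ = (t /ᵖ σ) · (u /ᵖ σ)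
  ƛ A u            /ᵖ σ = ƛ (A /ᶠ σ) (u /ᵖ σ)
  ι₀ u             /ᵖ σ = ι₀ (u /ᵖ σ)
  ι₁ u             /ᵖ σ = ι₁ (u /ᵖ σ)
  case u A w₁ B w₂ /ᵖ σ = case (u /ᵖ σ) (A /ᶠ σ) (w₁ /ᵖ σ) (B /ᶠ σ) (w₂ /ᵖ σ)
  (u ·ᵗ m)         /ᵖ σ = (u /ᵖ σ) ·ᵗ (m / σ)
  Λ u              /ᵖ σ = Λ (u /ᵖ (σ ↑))
  pack m u         /ᵖ σ = pack (m / σ) (u /ᵖ σ)
  unpack u A t     /ᵖ σ = unpack (u /ᵖ σ) (A /ᶠ (σ ↑)) (t /ᵖ (σ ↑))
  𝒟 A B            /ᵖ σ = 𝒟 (A /ᶠ (σ ↑)) (B /ᶠ σ)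
  efq P u          /ᵖ σ = efq (P /ᵃ σ) (u /ᵖ σ)

  rename : Proof n k → Sub Fin k l → Proof n l
  rename (var x)            ρ = var (lookup ρ x)
  rename ⟨ u , t ⟩          ρ = ⟨ rename u ρ , rename t ρ ⟩
  rename (u π₀)             ρ = (rename u ρ) π₀
  rename (u π₁)             ρ = (rename u ρ) π₁
  rename (t · u)            ρ = rename t ρ · rename u ρ
  rename (ƛ A u)            ρ = ƛ A (rename u (ρ VarSubst.↑))
  rename (ι₀ u)             ρ = ι₀ (rename u ρ)
  rename (ι₁ u)             ρ = ι₁ (rename u ρ)
  rename (case u A w₁ B w₂) ρ = case (rename u ρ) A (rename w₁ (ρ VarSubst.↑))
                                                  B (rename w₂ (ρ VarSubst.↑))
  rename (u ·ᵗ m)           ρ = rename u ρ ·ᵗ m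
  rename (Λ u)              ρ = Λ (rename u ρ)
  rename (pack m u)         ρ = pack m (rename u ρ)
  rename (unpack u A t)     ρ = unpack (rename u ρ) A (rename t (ρ VarSubst.↑))
  rename (𝒟 A B)            ρ = 𝒟 A B
  rename (efq P u)          ρ = efq P (rename u ρ)

  proofSimple : Simple (Proof n)
  proofSimple = record { var = var ; weaken = λ t → rename t VarSubst.wk }

  open module ProofSimple {n} = Simple (proofSimple {n}) public
    using () renaming (_↑ to _↑ᵖ; sub to subᵖ)

  -- Crossing a first-order binder, as opposed to a proof-variable binder.

  _↑ᵗ : Sub (Proof n) k l → Sub (Proof (suc n)) k l
  θ ↑ᵗ = map (_/ᵖ wk) θ

  infixl 10 _//_

  _//_ : Proof n k → Sub (Proof n) k l → Proof n l
  var x            // θ = lookup θ x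
  ⟨ u , t ⟩        // θ = ⟨ u // θ , t // θ ⟩
  (u π₀)           // θ = (u // θ) π₀
  (u π₁)           // θ = (u // θ) π₁
  (t · u)          // θ = (t // θ) · (u // θ)
  ƛ A u            // θ = ƛ A (u // (θ ↑ᵖ))
  ι₀ u             // θ = ι₀ (u // θ)
  ι₁ u             // θ = ι₁ (u // θ)
  case u A w₁ B w₂ // θ = case (u // θ) A (w₁ // (θ ↑ᵖ)) B (w₂ // (θ ↑ᵖ))
  (u ·ᵗ m)         // θ = (u // θ) ·ᵗ m
  Λ u              // θ = Λ (u // (θ ↑ᵗ))
  pack m u         // θ = pack m (u // θ)
  unpack u A t     // θ = unpack (u // θ) A (t // ((θ ↑ᵗ) ↑ᵖ))
  𝒟 A B            // θ = 𝒟 A B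
  efq P u          // θ = efq P (u // θ)

  infixl 10 _[_]ᵗ _[_]ᵖ

  _[_]ᵗ : Proof (suc n) k → Term n → Proof n k
  u [ m ]ᵗ = u /ᵖ sub m

  _[_]ᵖ : Proof n (suc k) → Proof n k → Proof n k
  u [ t ]ᵖ = u // subᵖ t

  ----------------------------------------------------------------------
  -- Typing

  Ctx : ℕ → ℕ → Set
  Ctx n k = Vec (Formula n) k

  -- The variable conditions on Λ, unpack and 𝒟 (α not free in some formula)
  -- become the requirement that this formula is a weakening.

  infix 4 _⊢_∶_ CD⊢_∶_

  data _⊢_∶_ {n k : ℕ} (Γ : Ctx n k) : Proof n k → Formula n → Set where
    ax  : (x : Fin k) → Γ ⊢ var x ∶ lookup Γ x
    ∧I  : ∀ {u t A B} → Γ ⊢ u ∶ A → Γ ⊢ t ∶ B → Γ ⊢ ⟨ u , t ⟩ ∶ A ∧ B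
    ∧E₀ : ∀ {u A B} → Γ ⊢ u ∶ A ∧ B → Γ ⊢ u π₀ ∶ A
    ∧E₁ : ∀ {u A B} → Γ ⊢ u ∶ A ∧ B → Γ ⊢ u π₁ ∶ B
    ⇒E  : ∀ {t u A B} → Γ ⊢ t ∶ A ⇒ B → Γ ⊢ u ∶ A → Γ ⊢ t · u ∶ B
    ⇒I  : ∀ {u A B} → (A ∷ Γ) ⊢ u ∶ B → Γ ⊢ ƛ A u ∶ A ⇒ B
    ∨I₀ : ∀ {u A B} → Γ ⊢ u ∶ A → Γ ⊢ ι₀ u ∶ A ∨ B
    ∨I₁ : ∀ {u A B} → Γ ⊢ u ∶ B → Γ ⊢ ι₁ u ∶ A ∨ B
    ∨E  : ∀ {u w₁ w₂ A B C} → Γ ⊢ u ∶ A ∨ B →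
          (A ∷ Γ) ⊢ w₁ ∶ C → (B ∷ Γ) ⊢ w₂ ∶ C → Γ ⊢ case u A w₁ B w₂ ∶ C
    ∀E  : ∀ {u A} → Γ ⊢ u ∶ ∀′ A → (m : Term n) → Γ ⊢ u ·ᵗ m ∶ A [ m ]ᶠ
    ∀I  : ∀ {u A} → map weakenᶠ Γ ⊢ u ∶ A → Γ ⊢ Λ u ∶ ∀′ A
    ∃I  : ∀ {u A} (m : Term n) → Γ ⊢ u ∶ A [ m ]ᶠ → Γ ⊢ pack m u ∶ ∃′ A
    ∃E  : ∀ {u t A C} → Γ ⊢ u ∶ ∃′ A →
          (A ∷ map weakenᶠ Γ) ⊢ t ∶ weakenᶠ C → Γ ⊢ unpack u A t ∶ C
    cd  : ∀ A B → Γ ⊢ 𝒟 A B ∶ (∀′ (A ∨ weakenᶠ B)) ⇒ ((∀′ A) ∨ B)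
    ⊥E  : ∀ {u} (P : Atom n) → Γ ⊢ u ∶ ⊥ᶠ → Γ ⊢ efq P u ∶ atom P

  CD⊢_∶_ : Proof n 0 → Formula n → Set
  CD⊢ t ∶ A = [] ⊢ t ∶ A

  ----------------------------------------------------------------------
  -- Reduction

  infix 4 _▷_ _↦_

  data _▷_ {n k : ℕ} : Proof n k → Proof n k → Set where
    β-⇒  : ∀ {A u t} → ƛ A u · t ▷ u [ t ]ᵖ
    β-∀  : ∀ {u m} → Λ u ·ᵗ m ▷ u [ m ]ᵗ
    β-∧₀ : ∀ {u₀ u₁} → ⟨ u₀ , u₁ ⟩ π₀ ▷ u₀
    β-∧₁ : ∀ {u₀ u₁} → ⟨ u₀ , u₁ ⟩ π₁ ▷ u₁
    β-∨₀ : ∀ {u A t₀ B t₁} → case (ι₀ u) A t₀ B t₁ ▷ t₀ [ u ]ᵖ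
    β-∨₁ : ∀ {u A t₀ B t₁} → case (ι₁ u) A t₀ B t₁ ▷ t₁ [ u ]ᵖ
    β-∃  : ∀ {m u A v} → unpack (pack m u) A v ▷ v [ m ]ᵗ [ u ]ᵖ
    β-𝒟₀ : ∀ {A B u} → 𝒟 A B · Λ (ι₀ u) ▷ ι₀ (Λ u)
    β-𝒟₁ : ∀ {A B u} → 𝒟 A B · Λ (ι₁ u) ▷ ι₁ (u [ const 𝟘 ]ᵗ)

  data _↦_ {n k : ℕ} : Proof n k → Proof n k → Set where
    root    : ∀ {t t′} → t ▷ t′ → t ↦ t′
    pairˡ   : ∀ {u u′ t} → u ↦ u′ → ⟨ u , t ⟩ ↦ ⟨ u′ , t ⟩
    pairʳ   : ∀ {u t t′} → t ↦ t′ → ⟨ u , t ⟩ ↦ ⟨ u , t′ ⟩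
    in-π₀   : ∀ {u u′} → u ↦ u′ → u π₀ ↦ u′ π₀
    in-π₁   : ∀ {u u′} → u ↦ u′ → u π₁ ↦ u′ π₁
    appˡ    : ∀ {t t′ u} → t ↦ t′ → t · u ↦ t′ · u
    appʳ    : ∀ {t u u′} → u ↦ u′ → t · u ↦ t · u′
    in-ƛ    : ∀ {A u u′} → u ↦ u′ → ƛ A u ↦ ƛ A u′
    in-ι₀   : ∀ {u u′} → u ↦ u′ → ι₀ u ↦ ι₀ u′
    in-ι₁   : ∀ {u u′} → u ↦ u′ → ι₁ u ↦ ι₁ u′
    case₀   : ∀ {u u′ A w₁ B w₂} → u ↦ u′ →
              case u A w₁ B w₂ ↦ case u′ A w₁ B w₂
    case₁   : ∀ {u A w₁ w₁′ B w₂} → w₁ ↦ w₁′ →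
              case u A w₁ B w₂ ↦ case u A w₁′ B w₂
    case₂   : ∀ {u A w₁ B w₂ w₂′} → w₂ ↦ w₂′ →
              case u A w₁ B w₂ ↦ case u A w₁ B w₂′
    in-·ᵗ   : ∀ {u u′ m} → u ↦ u′ → u ·ᵗ m ↦ u′ ·ᵗ m
    in-Λ    : ∀ {u u′} → u ↦ u′ → Λ u ↦ Λ u′
    in-pack : ∀ {m u u′} → u ↦ u′ → pack m u ↦ pack m u′
    unpack₀ : ∀ {u u′ A t} → u ↦ u′ → unpack u A t ↦ unpack u′ A t
    unpack₁ : ∀ {u A t t′} → t ↦ t′ → unpack u A t ↦ unpack u A t′
    in-efq  : ∀ {P u u′} → u ↦ u′ → efq P u ↦ efq P u′

  Normal : Proof n k → Set
  Normal = IsNormalForm _↦_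

{-# OPTIONS --safe #-}
module Submission where

-- Every closed normal proof is an introduction or a constant 𝒟; all three
-- claims are read off this, because no 𝒟 has an existential, disjunctive or
-- universal type.  It is proved by induction on the typing derivation
-- (closed-normal-canonical), simultaneously for all types:
--
--   * An elimination other than efq has a closed normal major premise, which by
--     induction is an introduction, so that the elimination is a redex, or
--     else is 𝒟.
--   * If 𝒟 is applied to u : ∀α(A ∨ B), then by induction u = λα v, and v is
--     again closed (it has no free proof variable, although α may occur in it)
--     and normal, so v = ι₀ w or v = ι₁ w.  Hence 𝒟 u is a redex.
--   * In efq u, by induction u : ⊥ would be canonical; but no introduction and
--     no 𝒟 has an atomic type.

open import Defs
open import Data.Empty using (⊥-elim)
open import Data.Nat.Base using (ℕ; suc)
open import Data.Product.Base using (∃; ∃₂; _×_; _,_)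
open import Data.Sum.Base using (_⊎_; inj₁; inj₂)
open import Relation.Binary.PropositionalEquality using (_≡_; refl)

module _ {𝓛 : Language} where

  open CD 𝓛

  -- Canonical t A: the proof t of A without free proof variables is an
  -- introduction, or a constant 𝒟.  Typings of the components are kept for
  -- disjunctions and quantifiers only.  The body of Λ is required to be
  -- canonical in turn: the redexes of 𝒟 look at the head of that body, and the
  -- induction hypothesis for Λ has to provide it.
  data Canonical {n : ℕ} : Proof n 0 → Formula n → Set where
    pair : ∀ {u t A B} → Canonical ⟨ u , t ⟩ (A ∧ B)
    lam  : ∀ {u A B} → Canonical (ƛ A u) (A ⇒ B)
    inl  : ∀ {u A B} → CD⊢ u ∶ A → Canonical (ι₀ u) (A ∨ B)
    inr  : ∀ {u A B} → CD⊢ u ∶ B → Canonical (ι₁ u) (A ∨ B)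
    gen  : ∀ {u A} → CD⊢ u ∶ A → Canonical u A → Canonical (Λ u) (∀′ A)
    pack : ∀ {u A} (m : Term n) → CD⊢ u ∶ A [ m ]ᶠ →
           Canonical (pack m u) (∃′ A)
    dom  : ∀ {A B} →
           Canonical (𝒟 A B) ((∀′ (A ∨ weakenᶠ B)) ⇒ ((∀′ A) ∨ B))

  closed-normal-canonical : ∀ {n} {t : Proof n 0} {A} →
                            CD⊢ t ∶ A → Normal t → Canonical t A
  closed-normal-canonical (ax ()) nf
  closed-normal-canonical (∧I d e) nf = pair
  closed-normal-canonical (⇒I d)   nf = lam
  closed-normal-canonical (∨I₀ d)  nf = inl d
  closed-normal-canonical (∨I₁ d)  nf = inr d
  closed-normal-canonical (∀I d)   nf =
    gen d (closed-normal-canonical d λ (_ , r) → nf (_ , in-Λ r))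
  closed-normal-canonical (∃I m d) nf = pack m d
  closed-normal-canonical (cd A B) nf = dom
  closed-normal-canonical (∧E₀ d) nf
    with closed-normal-canonical d (λ (_ , r) → nf (_ , in-π₀ r))
  ... | pair = ⊥-elim (nf (_ , root β-∧₀))
  closed-normal-canonical (∧E₁ d) nf
    with closed-normal-canonical d (λ (_ , r) → nf (_ , in-π₁ r))
  ... | pair = ⊥-elim (nf (_ , root β-∧₁))
  closed-normal-canonical (⇒E d e) nf
    with closed-normal-canonical d (λ (_ , r) → nf (_ , appˡ r))
       | closed-normal-canonical e (λ (_ , r) → nf (_ , appʳ r))
  ... | lam | _             = ⊥-elim (nf (_ , root β-⇒))
  ... | dom | gen _ (inl _) = ⊥-elim (nf (_ , root β-𝒟₀))
  ... | dom | gen _ (inr _) = ⊥-elim (nf (_ , root β-𝒟₁))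
  closed-normal-canonical (∨E d _ _) nf
    with closed-normal-canonical d (λ (_ , r) → nf (_ , case₀ r))
  ... | inl _ = ⊥-elim (nf (_ , root β-∨₀))
  ... | inr _ = ⊥-elim (nf (_ , root β-∨₁))
  closed-normal-canonical (∀E d m) nf
    with closed-normal-canonical d (λ (_ , r) → nf (_ , in-·ᵗ r))
  ... | gen _ _ = ⊥-elim (nf (_ , root β-∀))
  closed-normal-canonical (∃E d _) nf
    with closed-normal-canonical d (λ (_ , r) → nf (_ , unpack₀ r))
  ... | pack _ _ = ⊥-elim (nf (_ , root β-∃))
  closed-normal-canonical (⊥E P d) nf
    with closed-normal-canonical d (λ (_ , r) → nf (_ , in-efq r))
  ... | ()

theorem2 : (𝓛 : Language) → let open CD 𝓛 in
    (∀ (n : ℕ) (A : Formula (suc n)) (t : Proof n 0) →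
    CD⊢ t ∶ ∃′ A → Normal t →
    ∃₂ λ (m : Term n) (u : Proof n 0) → t ≡ pack m u × CD⊢ u ∶ A [ m ]ᶠ)
    ×
    (∀ (n : ℕ) (A B : Formula n) (t : Proof n 0) →
    CD⊢ t ∶ A ∨ B → Normal t →
    (∃ λ (u : Proof n 0) → t ≡ ι₀ u × CD⊢ u ∶ A)
    ⊎ (∃ λ (u : Proof n 0) → t ≡ ι₁ u × CD⊢ u ∶ B))
    ×
    (∀ (n : ℕ) (A : Formula (suc n)) (t : Proof n 0) →
    CD⊢ t ∶ ∀′ A → Normal t →
    ∃ λ (u : Proof (suc n) 0) → t ≡ Λ u × CD⊢ u ∶ A)
theorem2 𝓛 = existential , disjunction , universal
  where
  open CD 𝓛

  existential : ∀ n (A : Formula (suc n)) (t : Proof n 0) →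
    CD⊢ t ∶ ∃′ A → Normal t →
    ∃₂ λ (m : Term n) (u : Proof n 0) → t ≡ pack m u × CD⊢ u ∶ A [ m ]ᶠ
  existential n A t d nf with closed-normal-canonical d nf
  ... | pack m e = m , _ , refl , e

  disjunction : ∀ n (A B : Formula n) (t : Proof n 0) →
    CD⊢ t ∶ A ∨ B → Normal t →
    (∃ λ (u : Proof n 0) → t ≡ ι₀ u × CD⊢ u ∶ A)
    ⊎ (∃ λ (u : Proof n 0) → t ≡ ι₁ u × CD⊢ u ∶ B)
  disjunction n A B t d nf with closed-normal-canonical d nf
  ... | inl e = inj₁ (_ , refl , e)
  ... | inr e = inj₂ (_ , refl , e)

  universal : ∀ n (A : Formula (suc n)) (t : Proof n 0) →
    CD⊢ t ∶ ∀′ A → Normal t →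
    ∃ λ (u : Proof (suc n) 0) → t ≡ Λ u × CD⊢ u ∶ A
  universal n A t d nf with closed-normal-canonical d nf
  ... | gen e _ = _ , refl , e
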